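{- Let $\mathcal{S} \subset \mathbb{N}$ be a finite set with $\hat{x} := \max \mathcal{S} \geq 1$. Then $\mathcal{C}(\mathcal{S})$ is exactly the union of $]0,1]$ and of the connected components of $\mathcal{C}(\mathcal{S}) \cap [1,+\infty[$, each of which is an interval of length at least $1/\hat{x}^2$. In particular, let $\tau \geq 1$ be a real number and suppose that $\mathcal{S}$ has no outliers and no missing values with respect to $\tau$. Then $\tau$ belongs to the one of these component intervals that is of the form $[a,b[$ with $b = \sup \mathcal{C}(\mathcal{S})$.
   Context: $\mathbb{N} = \{0,1,2,\dots\}$. For real $u<v$, $[u,v[$ denotes the half-open interval $\{t : u \le t < v\}$ and $]u,v] = \{t : u < t \le v\}$. For a real number $t>0$, the lattice associated to $t$ is $\mathcal{S}_t = \{ \lfloor t k \rfloor : k \in \mathbb{N} \}$. A positive real number $t$ is compatible with $\mathcal{S}$ if $\mathcal{S} \subset \mathcal{S}_t$, and $\mathcal{C}(\mathcal{S}) = \{ t > 0 : \mathcal{S} \subset \mathcal{S}_t \}$. The set $\mathcal{S}$ represents the set of distinct values observed in a finite sample of $X = \lfloor \tau N \rfloor$, with $N$ an $\mathbb{N}$-valued random variable. With respect to $\tau$, $\mathcal{S}$ has no outliers if $\mathcal{S} \subset \mathcal{S}_\tau$. It has no missing values if every nonzero element of $\mathcal{S}_\tau$ that is smaller than $\hat{x} = \max \mathcal{S}$ belongs to $\mathcal{S}$; the value $0$ lies in every lattice and may or may not belong to $\mathcal{S}$. -}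

module Defs where

open import Algebra.Bundles.Raw using (RawMonoid)
import Algebra.Definitions.RawMonoid as RawMonoidDefinitions
open import Data.Integer.Base as ℤ using (ℤ; +_)
open import Data.List.Base using (List)
import Data.List.Membership.Propositional as List
open import Data.Nat.Base as ℕ using (ℕ; NonZero)
open import Data.Nat.Properties using (m^n≢0)
open import Data.Product.Base using (∃; ∃₂; _×_; _,_)
open import Data.Rational.Base as ℚ using (ℚ; 0ℚ; 1ℚ; _/_)
import Data.Rational.Properties as ℚ
open import Level using (0ℓ; suc)
open import Relation.Binary.Definitions using (tri<; tri≈; tri>)
open import Relation.Binary.PropositionalEquality
  using (_≡_; _≢_; refl; sym; trans; cong; subst)
open import Relation.Nullary.Negation using (¬_; contradiction)
open import Relation.Unary
  using (Pred; _∈_; _∉_; _⊆_; _≐_; _∪_; _∩_; Satisfiable; Empty)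

------------------------------------------------------------------------
-- Real numbers

-- A real number is a Dedekind cut, given by its lower part: q ∈ lower x
-- says q < x.  These are classical cuts (no upper part, no locatedness);
-- they are the usual real line in the presence of excluded middle.

record ℝ : Set (suc 0ℓ) where
  field
    lower     : Pred ℚ 0ℓ
    inhabited : ∃ λ q → q ∈ lower
    bounded   : ∃ λ q → q ∉ lower
    downward  : ∀ {p q} → p ℚ.< q → q ∈ lower → p ∈ lower
    rounded   : ∀ {q} → q ∈ lower → ∃ λ r → q ℚ.< r × r ∈ lower

open ℝ public

infix 4 _≤ℝ_ _<ℝ_ _≈ℝ_
infixl 6 _+ℝ_

_≤ℝ_ : ℝ → ℝ → Set
x ≤ℝ y = lower x ⊆ lower y

_<ℝ_ : ℝ → ℝ → Set
x <ℝ y = ∃ λ q → q ∉ lower x × q ∈ lower y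

_≈ℝ_ : ℝ → ℝ → Set
x ≈ℝ y = x ≤ℝ y × y ≤ℝ x

private
  p-1<p : ∀ p → p ℚ.- 1ℚ ℚ.< p
  p-1<p p = subst (p ℚ.- 1ℚ ℚ.<_) (ℚ.+-identityʳ p)
    (ℚ.+-monoʳ-< p {ℚ.- 1ℚ} {0ℚ} (ℚ.negative⁻¹ (ℚ.- 1ℚ)))

  [p-s]+s≡p : ∀ p s → (p ℚ.- s) ℚ.+ s ≡ p
  [p-s]+s≡p p s = trans (ℚ.+-assoc p (ℚ.- s) s)
    (trans (cong (p ℚ.+_) (ℚ.+-inverseˡ s)) (ℚ.+-identityʳ p))

  [r+s]-s≡r : ∀ r s → (r ℚ.+ s) ℚ.- s ≡ r
  [r+s]-s≡r r s = trans (ℚ.+-assoc r s (ℚ.- s))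
    (trans (cong (r ℚ.+_) (ℚ.+-inverseʳ s)) (ℚ.+-identityʳ r))

  ∈∉⇒< : ∀ (x : ℝ) {p q} → p ∈ lower x → q ∉ lower x → p ℚ.< q
  ∈∉⇒< x {p} {q} p∈x q∉x with ℚ.<-cmp p q
  ... | tri< p<q _ _  = p<q
  ... | tri≈ _ refl _ = contradiction p∈x q∉x
  ... | tri> _ _ q<p  = contradiction (downward x q<p p∈x) q∉x

fromℚ : ℚ → ℝ
fromℚ q .lower       = ℚ._< q
fromℚ q .inhabited   = q ℚ.- 1ℚ , p-1<p q
fromℚ q .bounded     = q , ℚ.<-irrefl refl
fromℚ q .downward    = ℚ.<-trans
fromℚ q .rounded p<q = ℚ.<-dense p<q

fromℤ : ℤ → ℝ
fromℤ z = fromℚ (z / 1)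

0ℝ 1ℝ : ℝ
0ℝ = fromℤ (+ 0)
1ℝ = fromℤ (+ 1)

_+ℝ_ : ℝ → ℝ → ℝ
(x +ℝ y) .lower q = ∃₂ λ r s → r ∈ lower x × s ∈ lower y × q ≡ r ℚ.+ s
(x +ℝ y) .inhabited =
  let r , r∈x = inhabited x
      s , s∈y = inhabited y
  in r ℚ.+ s , r , s , r∈x , s∈y , refl
(x +ℝ y) .bounded =
  let r , r∉x = bounded x
      s , s∉y = bounded y
  in r ℚ.+ s , λ (r′ , s′ , r′∈x , s′∈y , eq) →
       ℚ.<-irrefl (sym eq) (ℚ.+-mono-< (∈∉⇒< x r′∈x r∉x) (∈∉⇒< y s′∈y s∉y))
(x +ℝ y) .downward {p} p<q (r , s , r∈x , s∈y , refl) =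
  p ℚ.- s , s ,
  downward x (subst (p ℚ.- s ℚ.<_) ([r+s]-s≡r r s) (ℚ.+-monoˡ-< (ℚ.- s) p<q)) r∈x ,
  s∈y , sym ([p-s]+s≡p p s)
(x +ℝ y) .rounded (r , s , r∈x , s∈y , refl) =
  let r′ , r<r′ , r′∈x = rounded x r∈x
  in r′ ℚ.+ s , ℚ.+-monoˡ-< s r<r′ , r′ , s , r′∈x , s∈y , refl

+ℝ-rawMonoid : RawMonoid (suc 0ℓ) 0ℓ
+ℝ-rawMonoid = record { Carrier = ℝ ; _≈_ = _≈ℝ_ ; _∙_ = _+ℝ_ ; ε = 0ℝ }

-- The product k · x of a natural number and a real number is the k-fold sum.
open RawMonoidDefinitions +ℝ-rawMonoid public using () renaming (_×_ to _·_)

------------------------------------------------------------------------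
-- Subsets of the real line

-- Excluded middle for Set₁ makes every Set₁-valued predicate equivalent
-- to a Set-valued one, so that this is the full power set.

Subset : Set (suc 0ℓ)
Subset = Pred ℝ 0ℓ

]_,_[ [_,_[ ]_,_] : ℝ → ℝ → Subset
] a , b [ t = a <ℝ t × t <ℝ b
[ a , b [ t = a ≤ℝ t × t <ℝ b
] a , b ] t = a <ℝ t × t ≤ℝ b

[_,+∞[ : ℝ → Subset
[ a ,+∞[ t = a ≤ℝ t

IsSup : Subset → ℝ → Set (suc 0ℓ)
IsSup P b = (∀ {t} → t ∈ P → t ≤ℝ b)
          × (∀ {c} → (∀ {t} → t ∈ P → t ≤ℝ c) → b ≤ℝ c)

IsInf : Subset → ℝ → Set (suc 0ℓ)
IsInf P a = (∀ {t} → t ∈ P → a ≤ℝ t)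
          × (∀ {c} → (∀ {t} → t ∈ P → c ≤ℝ t) → c ≤ℝ a)

IsInterval : Subset → Set (suc 0ℓ)
IsInterval I = ∀ {x y z} → x ∈ I → z ∈ I → x ≤ℝ y → y ≤ℝ z → y ∈ I

LengthAtLeast : ℚ → Subset → Set (suc 0ℓ)
LengthAtLeast δ I = ∃₂ λ a b → IsInf I a × IsSup I b × a +ℝ fromℚ δ ≤ℝ b

Open : Subset → Set (suc 0ℓ)
Open U = ∀ {x} → x ∈ U →
  ∃₂ λ a b → x ∈ ] a , b [ × ] a , b [ ⊆ U

Connected : Subset → Set (suc 0ℓ)
Connected K = ∀ {U V} → Open U → Open V → K ⊆ U ∪ V →
  Satisfiable (K ∩ U) → Satisfiable (K ∩ V) → ¬ Empty (K ∩ (U ∩ V))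

IsComponent : Subset → Subset → Set (suc 0ℓ)
IsComponent A K = Satisfiable K × K ⊆ A × Connected K
  × (∀ {K′ : Subset} → K′ ⊆ A → Connected K′ → K ⊆ K′ → K′ ⊆ K)

⋃Components : Subset → Pred ℝ (suc 0ℓ)
⋃Components A t = ∃ λ K → IsComponent A K × t ∈ K

------------------------------------------------------------------------
-- Lattices and compatibility

IsFloor : ℝ → ℤ → Set
IsFloor x z = fromℤ z ≤ℝ x × x <ℝ fromℤ (ℤ.suc z)

-- The lattice 𝒮ₜ; for t > 0 the floors ⌊tk⌋ are natural numbers.
Lattice : ℝ → Pred ℕ 0ℓ
Lattice t n = ∃ λ k → IsFloor (k · t) (+ n)

-- Finite sets of natural numbers are given by a list of their elements,
-- repetitions being allowed and irrelevant.

⟦_⟧ : List ℕ → Pred ℕ 0ℓ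
⟦ S ⟧ n = n List.∈ S

IsMax : List ℕ → ℕ → Set
IsMax S m = m ∈ ⟦ S ⟧ × (∀ {n} → n ∈ ⟦ S ⟧ → n ℕ.≤ m)

𝒞 : List ℕ → Subset
𝒞 S t = 0ℝ <ℝ t × ⟦ S ⟧ ⊆ Lattice t

NoOutliers : List ℕ → ℝ → Set
NoOutliers S τ = ⟦ S ⟧ ⊆ Lattice τ

NoMissingValues : List ℕ → ℝ → Set
NoMissingValues S τ = ∀ {x̂} → IsMax S x̂ →
  ∀ {n} → n ∈ Lattice τ → n ≢ 0 → n ℕ.< x̂ → n ∈ ⟦ S ⟧

1/_² : (n : ℕ) .{{_ : NonZero n}} → ℚ
1/ n ² = _/_ (+ 1) (n ℕ.^ 2) {{m^n≢0 n 2}}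

IsTopComponent : List ℕ → Subset → Set (suc 0ℓ)
IsTopComponent S K = IsComponent (𝒞 S ∩ [ 1ℝ ,+∞[) K
  × ∃₂ λ a b → K ≐ [ a , b [ × IsSup (𝒞 S) b

{-# OPTIONS --safe #-}

-- For t ≥ 1 and 1 ≤ n ≤ x̂, the relation n = ⌊kt⌋ says n/k ≤ t < (n+1)/k and forces k ≤ x̂.
-- Hence every t ≥ 1 compatible with S lies in an interval [a,b[ of compatible numbers whose
-- endpoints belong to a finite grid of fractions with denominators at most x̂.  Components are
-- the classes of the relation "everything between s and t is compatible"; taking the extreme grid
-- points, each component is itself of the form [a,b[ with a and b in the grid, and two distinct
-- grid points differ by at least 1/x̂².  If S consists of all the values ⌊jτ⌋ ≤ x̂ (up to 0) and
-- t ≥ τ is compatible with S, then ⌊jt⌋ = ⌊jτ⌋ for each such j, so that all of [τ,t] is compatible.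

module Submission where

open import Defs
open import Axiom.ExcludedMiddle using (ExcludedMiddle)
open import Data.Integer.Base as ℤ using (+_)
import Data.Integer.Properties as ℤ
open import Data.List.Base using (List; []; _∷_; filter; upTo; cartesianProductWith)
import Data.List.Membership.Propositional as List
open import Data.List.Membership.Propositional.Properties
  using (∈-filter⁺; ∈-filter⁻; ∈-upTo⁺; ∈-upTo⁻; ∈-cartesianProductWith⁺; ∈-cartesianProductWith⁻)
open import Data.List.Relation.Unary.All using (lookup; tabulate)
open import Data.List.Relation.Unary.Any using (here; there)
open import Data.Nat.Base as ℕ using (ℕ; _≥_; >-nonZero)
open import Data.Nat.Induction using (<-rec)
import Data.Nat.Properties as ℕ
open import Data.Nat.Solver using (module +-*-Solver)
open import Data.Product using (_×_; ∃!; ∃; ∃₂; _,_; proj₁; proj₂)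
open import Data.Rational.Base as ℚ using (ℚ; 0ℚ; 1ℚ; _/_; toℚᵘ)
import Data.Rational.Properties as ℚ
open import Data.Rational.Unnormalised.Base as ℚᵘ using (mkℚᵘ)
import Data.Rational.Unnormalised.Properties as ℚᵘ
open import Data.Sum.Base as Sum using (_⊎_; inj₁; inj₂)
open import Function.Base using (id)
open import Level using (0ℓ; suc; Lift; lift)
open import Relation.Binary.Bundles using (DecTotalOrder)
open import Relation.Binary.Definitions using (tri<; tri≈; tri>)
open import Relation.Binary.PropositionalEquality
open import Relation.Nullary using (Dec; yes; no; ¬_; contradiction)
open import Relation.Nullary.Decidable using (True; toWitness; fromWitness; decidable-stable)
open import Relation.Unary using (Pred; Satisfiable; _∈_; _∉_; _⊆_; _≐_; _∪_; _∩_)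
open import Relation.Unary.Properties using (≐-trans)

open import Data.List.Extrema (DecTotalOrder.totalOrder ℚ.≤-decTotalOrder)
  using (max; min; argmax-all; argmin-all; xs≤max; min≤xs)

-- Fractions

infix 8 _÷_

-- The denominator is `suc k`: `p ÷ k` is p/(k+1), and an index k < m means a denominator at most m.
_÷_ : ℕ → ℕ → ℚ
p ÷ k = + p / ℕ.suc k

÷≃ : ∀ p k → toℚᵘ (p ÷ k) ℚᵘ.≃ mkℚᵘ (+ p) k
÷≃ p k = ℚ.toℚᵘ-fromℚᵘ (mkℚᵘ (+ p) k)

÷-mono-< : ∀ p k q l → p ℕ.* ℕ.suc l ℕ.< q ℕ.* ℕ.suc k → p ÷ k ℚ.< q ÷ l
÷-mono-< p k q l lt = ℚ.toℚᵘ-cancel-< (ℚᵘ.<-respˡ-≃ (ℚᵘ.≃-sym (÷≃ p k))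
  (ℚᵘ.<-respʳ-≃ (ℚᵘ.≃-sym (÷≃ q l)) (ℚᵘ.*<* (subst₂ ℤ._<_ (ℤ.pos-* p (ℕ.suc l)) (ℤ.pos-* q (ℕ.suc k)) (ℤ.+<+ lt)))))

÷-mono-≤ : ∀ p k q l → p ℕ.* ℕ.suc l ℕ.≤ q ℕ.* ℕ.suc k → p ÷ k ℚ.≤ q ÷ l
÷-mono-≤ p k q l le = ℚ.toℚᵘ-cancel-≤ (ℚᵘ.≤-respˡ-≃ (ℚᵘ.≃-sym (÷≃ p k))
  (ℚᵘ.≤-respʳ-≃ (ℚᵘ.≃-sym (÷≃ q l)) (ℚᵘ.*≤* (subst₂ ℤ._≤_ (ℤ.pos-* p (ℕ.suc l)) (ℤ.pos-* q (ℕ.suc k)) (ℤ.+≤+ le)))))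

÷-cancel-< : ∀ p k q l → p ÷ k ℚ.< q ÷ l → p ℕ.* ℕ.suc l ℕ.< q ℕ.* ℕ.suc k
÷-cancel-< p k q l lt = ℕ.≰⇒> λ le →
  ℚ.<-irrefl refl (ℚ.<-≤-trans lt (÷-mono-≤ q l p k le))

-- The index on the right is (k+1)(l+1) - 1, so the denominator is the plain product.
÷-+ : ∀ p k q l → p ÷ k ℚ.+ q ÷ l ≡ (p ℕ.* ℕ.suc l ℕ.+ q ℕ.* ℕ.suc k) ÷ (l ℕ.+ k ℕ.* ℕ.suc l)
÷-+ p k q l = ℚ.toℚᵘ-injective (begin
  toℚᵘ (p ÷ k ℚ.+ q ÷ l)           ≈⟨ ℚ.toℚᵘ-homo-+ (p ÷ k) (q ÷ l) ⟩
  toℚᵘ (p ÷ k) ℚᵘ.+ toℚᵘ (q ÷ l)   ≈⟨ ℚᵘ.+-cong (÷≃ p k) (÷≃ q l) ⟩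
  mkℚᵘ (+ p) k ℚᵘ.+ mkℚᵘ (+ q) l   ≡⟨ cong (λ z → mkℚᵘ z (l ℕ.+ k ℕ.* ℕ.suc l))
                                       (cong₂ ℤ._+_ (sym (ℤ.pos-* p (ℕ.suc l))) (sym (ℤ.pos-* q (ℕ.suc k)))) ⟩
  mkℚᵘ (+ (p ℕ.* ℕ.suc l ℕ.+ q ℕ.* ℕ.suc k)) (l ℕ.+ k ℕ.* ℕ.suc l) ≈⟨ ÷≃ _ _ ⟨
  toℚᵘ ((p ℕ.* ℕ.suc l ℕ.+ q ℕ.* ℕ.suc k) ÷ (l ℕ.+ k ℕ.* ℕ.suc l)) ∎)
  where open ℚᵘ.≃-Reasoning

÷0-suc : ∀ n → ℕ.suc n ÷ 0 ≡ 1ℚ ℚ.+ n ÷ 0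
÷0-suc n = sym (trans (÷-+ 1 0 n 0) (cong (λ m → ℕ.suc m ÷ 0) (ℕ.*-identityʳ n)))

*-÷ : ∀ p k → ℕ.suc k ÷ 0 ℚ.* p ÷ k ≡ p ÷ 0
*-÷ p k = ℚ.toℚᵘ-injective (begin
  toℚᵘ (ℕ.suc k ÷ 0 ℚ.* p ÷ k)                ≈⟨ ℚ.toℚᵘ-homo-* (ℕ.suc k ÷ 0) (p ÷ k) ⟩
  toℚᵘ (ℕ.suc k ÷ 0) ℚᵘ.* toℚᵘ (p ÷ k)        ≈⟨ ℚᵘ.*-cong (÷≃ (ℕ.suc k) 0) (÷≃ p k) ⟩
  mkℚᵘ (+ ℕ.suc k) 0 ℚᵘ.* mkℚᵘ (+ p) k        ≈⟨ ℚᵘ.*≡* (trans (ℤ.*-identityʳ _) (trans (ℤ.*-comm (+ ℕ.suc k) (+ p))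
                                                   (cong (+ p ℤ.*_) (cong (λ m → + ℕ.suc m) (sym (ℕ.+-identityʳ k)))))) ⟩
  mkℚᵘ (+ p) 0                                ≈⟨ ÷≃ p 0 ⟨
  toℚᵘ (p ÷ 0)                                ∎)
  where open ℚᵘ.≃-Reasoning

÷-pos : ∀ n k → ℚ.Positive (ℕ.suc n ÷ k)
÷-pos n k = ℚ.normalize-pos (ℕ.suc n) (ℕ.suc k)

-- The cross difference q(k+1) - p(l+1) is a positive integer, so the fractions differ by at least
-- 1/((k+1)(l+1)), and this product is at most m².
÷-gap : ∀ p k q l m .{{_ : ℕ.NonZero m}} → ℕ.suc k ℕ.≤ m → ℕ.suc l ℕ.≤ m →
        p ÷ k ℚ.< q ÷ l → p ÷ k ℚ.+ 1/ m ² ℚ.≤ q ÷ l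
÷-gap p k q l (ℕ.suc m) k<m l<m lt = begin
  p ÷ k ℚ.+ 1/ ℕ.suc m ²                     ≤⟨ ℚ.+-monoʳ-≤ (p ÷ k) 1/m²≤1÷e ⟩
  p ÷ k ℚ.+ 1 ÷ e                            ≡⟨ ÷-+ p k 1 e ⟩
  (p ℕ.* ℕ.suc e ℕ.+ 1 ℕ.* ℕ.suc k) ÷ (e ℕ.+ k ℕ.* ℕ.suc e)
                                             ≤⟨ ÷-mono-≤ (p ℕ.* ℕ.suc e ℕ.+ 1 ℕ.* ℕ.suc k) (e ℕ.+ k ℕ.* ℕ.suc e) q l cross ⟩
  q ÷ l                                      ∎
  where
  open ℚ.≤-Reasoning
  e = l ℕ.+ k ℕ.* ℕ.suc l
  1/m²≤1÷e : 1/ ℕ.suc m ² ℚ.≤ 1 ÷ e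
  1/m²≤1÷e = ÷-mono-≤ 1 _ 1 e (ℕ.*-monoʳ-≤ 1 (ℕ.*-mono-≤ k<m
    (ℕ.≤-trans l<m (ℕ.≤-reflexive (sym (ℕ.*-identityʳ _))))))
  cross : (p ℕ.* ℕ.suc e ℕ.+ 1 ℕ.* ℕ.suc k) ℕ.* ℕ.suc l ℕ.≤ q ℕ.* ℕ.suc (e ℕ.+ k ℕ.* ℕ.suc e)
  -- `suc e` is (k+1)(l+1), and the claim is p(l+1) + 1 ≤ q(k+1) multiplied by it.
  cross = subst₂ ℕ._≤_
    (solve 3 (λ p k l → k :* l :* (con 1 :+ p :* l) := (p :* (k :* l) :+ con 1 :* k) :* l)
      refl p (ℕ.suc k) (ℕ.suc l))
    (solve 3 (λ e q k → e :* (q :* k) := q :* (k :* e)) refl (ℕ.suc e) q (ℕ.suc k))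
    (ℕ.*-monoʳ-≤ (ℕ.suc e) (÷-cancel-< p k q l lt))
    where open +-*-Solver

-- Order on cuts and comparison with rationals

∈∉⇒< : ∀ x {p q} → p ∈ lower x → q ∉ lower x → p ℚ.< q
∈∉⇒< x {p} {q} p∈x q∉x with ℚ.<-cmp p q
... | tri< p<q _ _  = p<q
... | tri≈ _ refl _ = contradiction p∈x q∉x
... | tri> _ _ q<p  = contradiction (downward x q<p p∈x) q∉x

downward-≤ : ∀ x {p q} → p ℚ.≤ q → q ∈ lower x → p ∈ lower x
downward-≤ x {p} {q} p≤q q∈x with ℚ.<-cmp p q
... | tri< p<q _ _  = downward x p<q q∈x
... | tri≈ _ refl _ = q∈x
... | tri> _ _ q<p  = contradiction (ℚ.<-≤-trans q<p p≤q) (ℚ.<-irrefl refl)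

⊔-∈ : ∀ x {p q} → p ∈ lower x → q ∈ lower x → p ℚ.⊔ q ∈ lower x
⊔-∈ x {p} {q} p∈x q∈x with ℚ.⊔-sel p q
... | inj₁ eq = subst (_∈ lower x) (sym eq) p∈x
... | inj₂ eq = subst (_∈ lower x) (sym eq) q∈x

<⇒≤ : ∀ {x y} → x <ℝ y → x ≤ℝ y
<⇒≤ {x} {y} (q , q∉x , q∈y) p∈x = downward y (∈∉⇒< x p∈x q∉x) q∈y

<⇒≱ : ∀ {x y} → x <ℝ y → ¬ y ≤ℝ x
<⇒≱ (q , q∉x , q∈y) y≤x = q∉x (y≤x q∈y)

≤-<-trans : ∀ {x y z} → x ≤ℝ y → y <ℝ z → x <ℝ z
≤-<-trans x≤y (q , q∉y , q∈z) = q , (λ q∈x → q∉y (x≤y q∈x)) , q∈z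

<-≤-trans : ∀ {x y z} → x <ℝ y → y ≤ℝ z → x <ℝ z
<-≤-trans (q , q∉x , q∈y) y≤z = q , q∉x , y≤z q∈y

<-dense : ∀ {x y} → x <ℝ y → ∃ λ r → x <ℝ fromℚ r × fromℚ r <ℝ y
<-dense {x} {y} (q , q∉x , q∈y) =
  let r , q<r , r∈y = rounded y q∈y
  in r , (q , q∉x , q<r) , r , ℚ.<-irrefl refl , r∈y

fromℚ-mono-≤ : ∀ {p q} → p ℚ.≤ q → fromℚ p ≤ℝ fromℚ q
fromℚ-mono-≤ p≤q r<p = ℚ.<-≤-trans r<p p≤q

fromℚ-mono-< : ∀ {p q} → p ℚ.< q → fromℚ p <ℝ fromℚ q
fromℚ-mono-< {p} p<q = p , ℚ.<-irrefl refl , p<q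

fromℚ-cancel-< : ∀ {p q} → fromℚ p <ℝ fromℚ q → p ℚ.< q
fromℚ-cancel-< (r , r≮p , r<q) = ℚ.≤-<-trans (ℚ.≮⇒≥ r≮p) r<q

<ℝ-below : ∀ x → ∃ λ q → fromℚ q <ℝ x
<ℝ-below x = let q , q∈x = inhabited x in q , q , ℚ.<-irrefl refl , q∈x

p<p+1 : ∀ p → p ℚ.< p ℚ.+ 1ℚ
p<p+1 p = subst (ℚ._< p ℚ.+ 1ℚ) (ℚ.+-identityʳ p) (ℚ.+-monoʳ-< p (ℚ.positive⁻¹ 1ℚ))

<ℝ-above : ∀ x → ∃ λ q → x <ℝ fromℚ q
<ℝ-above x = let q , q∉x = bounded x in q ℚ.+ 1ℚ , q , q∉x , p<p+1 q

fromℤ-cancel-< : ∀ {m n} → fromℤ (+ m) <ℝ fromℤ (+ n) → m ℕ.< n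
fromℤ-cancel-< {m} {n} lt = subst₂ ℕ._<_ (ℕ.*-identityʳ m) (ℕ.*-identityʳ n)
  (÷-cancel-< m 0 n 0 (fromℚ-cancel-< lt))

fromℤ-mono-≤ : ∀ {m n} → m ℕ.≤ n → fromℤ (+ m) ≤ℝ fromℤ (+ n)
fromℤ-mono-≤ {m} {n} m≤n = fromℚ-mono-≤ (÷-mono-≤ m 0 n 0 (ℕ.*-monoˡ-≤ 1 m≤n))

fromℤ-mono-< : ∀ {m n} → m ℕ.< n → fromℤ (+ m) <ℝ fromℤ (+ n)
fromℤ-mono-< {m} {n} m<n = fromℚ-mono-< (÷-mono-< m 0 n 0 (ℕ.*-monoˡ-< 1 m<n))

-- Multiples and floors

·-monoʳ-≤ : ∀ k {x y} → x ≤ℝ y → k · x ≤ℝ k · y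
·-monoʳ-≤ ℕ.zero    x≤y p = p
·-monoʳ-≤ (ℕ.suc k) {x} {y} x≤y (r , s , r∈x , s∈kx , eq) =
  r , s , x≤y r∈x , ·-monoʳ-≤ k {x} {y} x≤y s∈kx , eq

1+*-distrib : ∀ k r → ℕ.suc (ℕ.suc k) ÷ 0 ℚ.* r ≡ r ℚ.+ ℕ.suc k ÷ 0 ℚ.* r
1+*-distrib k r = begin
  ℕ.suc (ℕ.suc k) ÷ 0 ℚ.* r         ≡⟨ cong (ℚ._* r) (÷0-suc (ℕ.suc k)) ⟩
  (1ℚ ℚ.+ ℕ.suc k ÷ 0) ℚ.* r        ≡⟨ ℚ.*-distribʳ-+ r 1ℚ (ℕ.suc k ÷ 0) ⟩
  1ℚ ℚ.* r ℚ.+ ℕ.suc k ÷ 0 ℚ.* r    ≡⟨ cong (ℚ._+ ℕ.suc k ÷ 0 ℚ.* r) (ℚ.*-identityˡ r) ⟩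
  r ℚ.+ ℕ.suc k ÷ 0 ℚ.* r           ∎
  where open ≡-Reasoning

p+[q-p]≡q : ∀ p q → p ℚ.+ (q ℚ.- p) ≡ q
p+[q-p]≡q p q = begin
  p ℚ.+ (q ℚ.- p)       ≡⟨ cong (p ℚ.+_) (ℚ.+-comm q (ℚ.- p)) ⟩
  p ℚ.+ (ℚ.- p ℚ.+ q)   ≡⟨ ℚ.+-assoc p (ℚ.- p) q ⟨
  p ℚ.- p ℚ.+ q         ≡⟨ cong (ℚ._+ q) (ℚ.+-inverseʳ p) ⟩
  0ℚ ℚ.+ q            ≡⟨ ℚ.+-identityˡ q ⟩
  q                     ∎
  where open ≡-Reasoning

p<q⇒p-q<0 : ∀ {p q} → p ℚ.< q → p ℚ.- q ℚ.< 0ℚ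
p<q⇒p-q<0 {p} {q} p<q = subst (p ℚ.- q ℚ.<_) (ℚ.+-inverseʳ q) (ℚ.+-monoˡ-< (ℚ.- q) p<q)

-- The multiple is built from k+1 possibly different rationals below t; the largest of them can
-- replace them all.
∈-·⁻ : ∀ k t {q} → q ∈ lower (ℕ.suc k · t) → ∃ λ r → r ∈ lower t × q ℚ.≤ ℕ.suc k ÷ 0 ℚ.* r
∈-·⁻ ℕ.zero t (r , s , r∈t , s<0 , refl) = r , r∈t , (begin
  r ℚ.+ s     ≤⟨ ℚ.+-monoʳ-≤ r (ℚ.<⇒≤ s<0) ⟩
  r ℚ.+ 0ℚ  ≡⟨ ℚ.+-identityʳ r ⟩
  r           ≡⟨ ℚ.*-identityˡ r ⟨
  1ℚ ℚ.* r    ∎)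
  where open ℚ.≤-Reasoning
∈-·⁻ (ℕ.suc k) t (r , s , r∈t , s∈kt , refl) with ∈-·⁻ k t s∈kt
... | r′ , r′∈t , s≤κr′ = r ℚ.⊔ r′ , ⊔-∈ t r∈t r′∈t , (begin
  r ℚ.+ s                               ≤⟨ ℚ.+-monoʳ-≤ r s≤κr′ ⟩
  r ℚ.+ κ ℚ.* r′                        ≤⟨ ℚ.+-mono-≤ (ℚ.p≤p⊔q r r′)
                                             (ℚ.*-monoˡ-≤-nonNeg κ {{ℚ.pos⇒nonNeg κ {{÷-pos k 0}}}} (ℚ.p≤q⊔p r r′)) ⟩
  r ℚ.⊔ r′ ℚ.+ κ ℚ.* (r ℚ.⊔ r′)         ≡⟨ 1+*-distrib k (r ℚ.⊔ r′) ⟨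
  ℕ.suc (ℕ.suc k) ÷ 0 ℚ.* (r ℚ.⊔ r′)    ∎)
  where
  open ℚ.≤-Reasoning
  κ = ℕ.suc k ÷ 0

∈-·⁺ : ∀ k t {r} → r ∈ lower t → ℕ.suc k ÷ 0 ℚ.* r ∈ lower (ℕ.suc k · t)
∈-·⁺ ℕ.zero t {r} r∈t =
  let r′ , r<r′ , r′∈t = rounded t r∈t
  in r′ , r ℚ.- r′ , r′∈t , p<q⇒p-q<0 r<r′ , trans (ℚ.*-identityˡ r) (sym (p+[q-p]≡q r′ r))
∈-·⁺ (ℕ.suc k) t {r} r∈t = r , ℕ.suc k ÷ 0 ℚ.* r , r∈t , ∈-·⁺ k t r∈t , 1+*-distrib k r

≤·⇒÷≤ : ∀ n k t → fromℤ (+ n) ≤ℝ ℕ.suc k · t → fromℚ (n ÷ k) ≤ℝ t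
≤·⇒÷≤ n k t n≤kt {q} q<n÷k =
  let r , r∈t , κq≤κr = ∈-·⁻ k t (n≤kt (subst (ℕ.suc k ÷ 0 ℚ.* q ℚ.<_) (*-÷ n k)
                          (ℚ.*-monoʳ-<-pos (ℕ.suc k ÷ 0) {{÷-pos k 0}} q<n÷k)))
  in downward-≤ t (ℚ.*-cancelˡ-≤-pos (ℕ.suc k ÷ 0) {{÷-pos k 0}} κq≤κr) r∈t

÷≤⇒≤· : ∀ n k t → fromℚ (n ÷ k) ≤ℝ t → fromℤ (+ n) ≤ℝ ℕ.suc k · t
÷≤⇒≤· n k t n÷k≤t {q} q<n = subst (_∈ lower (ℕ.suc k · t)) κ[q÷κ]≡q (∈-·⁺ k t (n÷k≤t q÷κ<n÷k))
  where
  κ = ℕ.suc k ÷ 0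
  instance
    κ≢0 : ℚ.NonZero κ
    κ≢0 = ℚ.pos⇒nonZero κ {{÷-pos k 0}}
  κ[q÷κ]≡q : κ ℚ.* (ℚ.1/ κ ℚ.* q) ≡ q
  κ[q÷κ]≡q = trans (sym (ℚ.*-assoc κ (ℚ.1/ κ) q)) (trans (cong (ℚ._* q) (ℚ.*-inverseʳ κ)) (ℚ.*-identityˡ q))
  q÷κ<n÷k : ℚ.1/ κ ℚ.* q ℚ.< n ÷ k
  q÷κ<n÷k = ℚ.*-cancelˡ-<-nonNeg κ {{ℚ.pos⇒nonNeg κ {{÷-pos k 0}}}}
    (subst₂ ℚ._<_ (sym κ[q÷κ]≡q) (sym (*-÷ n k)) q<n)

floor-unique : ∀ x {m n} → IsFloor x (+ m) → IsFloor x (+ n) → m ≡ n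
floor-unique x {m} {n} (m≤x , x<1+m) (n≤x , x<1+n) = ℕ.≤-antisym
  (ℕ.s≤s⁻¹ (fromℤ-cancel-< {m} {ℕ.suc n} (≤-<-trans {fromℤ (+ m)} {x} {fromℤ (+ ℕ.suc n)} m≤x x<1+n)))
  (ℕ.s≤s⁻¹ (fromℤ-cancel-< {n} {ℕ.suc m} (≤-<-trans {fromℤ (+ n)} {x} {fromℤ (+ ℕ.suc m)} n≤x x<1+m)))

floor-0 : IsFloor 0ℝ (+ 0)
floor-0 = (λ q<0 → q<0) , fromℤ-mono-< {0} {1} ℕ.z<s

-- Consequences of excluded middle

module Classical (em : ExcludedMiddle (suc 0ℓ)) where

  em₀ : (P : Set) → Dec P
  em₀ P with em {Lift (suc 0ℓ) P}
  ... | yes (lift p) = yes p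
  ... | no ¬p        = no λ p → ¬p (lift p)

  ≮⇒≥ : ∀ {x y} → ¬ x <ℝ y → y ≤ℝ x
  ≮⇒≥ x≮y {q} q∈y = decidable-stable (em₀ _) λ q∉x → x≮y (q , q∉x , q∈y)

  <-≤-connex : ∀ x y → x <ℝ y ⊎ y ≤ℝ x
  <-≤-connex x y with em₀ (x <ℝ y)
  ... | yes x<y = inj₁ x<y
  ... | no x≮y  = inj₂ (≮⇒≥ {x} {y} x≮y)

  ≤ℝ-total : ∀ x y → x ≤ℝ y ⊎ y ≤ℝ x
  ≤ℝ-total x y with <-≤-connex x y
  ... | inj₁ x<y = inj₁ (<⇒≤ {x} {y} x<y)
  ... | inj₂ y≤x = inj₂ y≤x

  ·<⇒<÷ : ∀ n k t → ℕ.suc k · t <ℝ fromℤ (+ n) → t <ℝ fromℚ (n ÷ k)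
  ·<⇒<÷ n k t kt<n with <-≤-connex t (fromℚ (n ÷ k))
  ... | inj₁ t<n÷k = t<n÷k
  ... | inj₂ n÷k≤t = contradiction (λ {q} → ÷≤⇒≤· n k t n÷k≤t {q}) (<⇒≱ {ℕ.suc k · t} {fromℤ (+ n)} kt<n)

  <÷⇒·< : ∀ n k t → t <ℝ fromℚ (n ÷ k) → ℕ.suc k · t <ℝ fromℤ (+ n)
  <÷⇒·< n k t t<n÷k with <-≤-connex (ℕ.suc k · t) (fromℤ (+ n))
  ... | inj₁ kt<n = kt<n
  ... | inj₂ n≤kt = contradiction (λ {q} → ≤·⇒÷≤ n k t n≤kt {q}) (<⇒≱ {t} {fromℚ (n ÷ k)} t<n÷k)

  -- Intervals and connected sets

  -- The lower cut is the union of the lower cuts of the members. That union quantifies over reals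
  -- and lives in `Set₁`; `True` of its decision is a `Set`.
  supremum : ∀ P → Satisfiable P → (∃ λ c → ∀ {t} → t ∈ P → t ≤ℝ c) → ∃ (IsSup P)
  supremum P (t , t∈P) (c , P≤c) = s , (λ t∈P q∈t → fromWitness (_ , t∈P , q∈t)) ,
    λ P≤c q∈s → let t , t∈P , q∈t = toWitness q∈s in P≤c t∈P q∈t
    where
    s : ℝ
    s .lower q     = True (em {∃ λ t → t ∈ P × q ∈ lower t})
    s .inhabited   = let q , q∈t = inhabited t in q , fromWitness (t , t∈P , q∈t)
    s .bounded     = let q , q∉c = bounded c in q , λ q∈s →
      let t , t∈P , q∈t = toWitness q∈s in q∉c (P≤c t∈P q∈t)
    s .downward p<q q∈s =
      let t , t∈P , q∈t = toWitness q∈s in fromWitness (t , t∈P , downward t p<q q∈t)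
    s .rounded q∈s =
      let t , t∈P , q∈t = toWitness q∈s
          r , q<r , r∈t = rounded t q∈t
      in r , q<r , fromWitness (t , t∈P , r∈t)

  -- The two points are fixed, so that `interval⇒connected` can put them in order by exchanging U
  -- and V.
  Connects : Subset → ℝ → ℝ → Set₁
  Connects K x z = ∀ {U V} → Open U → Open V → K ⊆ U ∪ V → x ∈ U → z ∈ V → ∃ λ y → y ∈ K × y ∈ U × y ∈ V

  -- The supremum s of U ∩ [x,z] lies in K, and a neighbourhood of s contained in
  -- either one of U and V meets the other inside [x,z].
  ≤⇒connects : ∀ {K x z} → IsInterval K → x ∈ K → z ∈ K → x ≤ℝ z → Connects K x z
  ≤⇒connects {K} {x} {z} interval x∈K z∈K x≤z {U} {V} openU openV cover x∈U z∈V =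
    from-s (cover s∈K)
    where
    P : Subset
    P y = y ∈ U × x ≤ℝ y × y ≤ℝ z

    sup : ∃ (IsSup P)
    sup = supremum P (x , x∈U , (λ q → q) , x≤z) (z , λ (_ , _ , y≤z) → y≤z)

    s : ℝ
    s = proj₁ sup

    P≤s : ∀ {y} → y ∈ P → y ≤ℝ s
    P≤s = proj₁ (proj₂ sup)

    s≤ : ∀ {c} → (∀ {y} → y ∈ P → y ≤ℝ c) → s ≤ℝ c
    s≤ {c} = proj₂ (proj₂ sup) {c}

    s≤z : s ≤ℝ z
    s≤z = s≤ {z} λ (_ , _ , y≤z) → y≤z

    x≤s : x ≤ℝ s
    x≤s = P≤s (x∈U , (λ q → q) , x≤z)

    s∈K : s ∈ K
    s∈K = interval x∈K z∈K x≤s s≤z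

    not-past : ∀ {r} → s <ℝ fromℚ r → fromℚ r <ℝ z → fromℚ r ∉ U
    not-past {r} s<r r<z r∈U = <⇒≱ {s} {fromℚ r} s<r
      (P≤s (r∈U , (λ p → <⇒≤ {s} {fromℚ r} s<r (x≤s p)) , <⇒≤ {fromℚ r} {z} r<z))

    from-s : s ∈ U ∪ V → ∃ λ y → y ∈ K × y ∈ U × y ∈ V
    from-s (inj₁ s∈U) with openU s∈U
    ... | a , b , (a<s , s<b) , ]a,b[⊆U with <-≤-connex s z
    ...   | inj₂ z≤s = z , z∈K , ]a,b[⊆U (<-≤-trans {a} {s} {z} a<s s≤z , ≤-<-trans {z} {s} {b} z≤s s<b) , z∈V
    -- A rational slightly above s, below both b and z, would lie in U beyond the supremum, so s < z
    -- is impossible here.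
    ...   | inj₁ s<z with <-≤-connex b z
    ...     | inj₁ b<z =
      let r , s<r , r<b = <-dense {s} {b} s<b
      in contradiction (]a,b[⊆U (<-≤-trans {a} {s} {fromℚ r} a<s (<⇒≤ {s} {fromℚ r} s<r) , r<b))
           (not-past s<r (<-≤-trans {fromℚ r} {b} {z} r<b (<⇒≤ {b} {z} b<z)))
    ...     | inj₂ z≤b =
      let r , s<r , r<z = <-dense {s} {z} s<z
      in contradiction (]a,b[⊆U (<-≤-trans {a} {s} {fromℚ r} a<s (<⇒≤ {s} {fromℚ r} s<r) ,
                                 <-≤-trans {fromℚ r} {z} {b} r<z z≤b))
           (not-past s<r r<z)
    from-s (inj₂ s∈V) with openV s∈V
    ... | a , b , (a<s , s<b) , ]a,b[⊆V with em {∃ λ y → y ∈ P × a <ℝ y}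
    ...   | yes (y , y∈P@(y∈U , x≤y , y≤z) , a<y) =
      y , interval x∈K z∈K x≤y y≤z , y∈U , ]a,b[⊆V (a<y , ≤-<-trans {y} {s} {b} (P≤s y∈P) s<b)
    ...   | no ∄y = contradiction (λ {q} → s≤ {a} (λ {y} y∈P → ≮⇒≥ {a} {y} λ a<y → ∄y (y , y∈P , a<y)) {q})
                      (<⇒≱ {a} {s} a<s)

  interval⇒connected : ∀ {K} → IsInterval K → Connected K
  interval⇒connected {K} interval openU openV cover (x , x∈K , x∈U) (z , z∈K , z∈V) empty
    with ≤ℝ-total x z
  ... | inj₁ x≤z =
    let y , y∈K , y∈U , y∈V = ≤⇒connects {K} interval x∈K z∈K x≤z openU openV cover x∈U z∈V
    in empty y (y∈K , y∈U , y∈V)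
  ... | inj₂ z≤x =
    let y , y∈K , y∈V , y∈U = ≤⇒connects {K} interval z∈K x∈K z≤x openV openU
                                (λ w∈K → Sum.swap (cover w∈K)) z∈V x∈U
    in empty y (y∈K , y∈U , y∈V)

  open-below : ∀ z → Open (_<ℝ z)
  open-below z {x} x<z = let q , q<x = <ℝ-below x in fromℚ q , z , (q<x , x<z) , λ {y} (_ , y<z) → y<z

  open-above : ∀ z → Open (z <ℝ_)
  open-above z {x} z<x = let q , x<q = <ℝ-above x in z , fromℚ q , (z<x , x<q) , λ {y} (z<y , _) → z<y

  [,[-interval : ∀ a b → IsInterval [ a , b [
  [,[-interval a b {x} {y} {z} (a≤x , _) (_ , z<b) x≤y y≤z =
    (λ q → x≤y (a≤x q)) , ≤-<-trans {y} {z} {b} y≤z z<b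

  -- If c < b, a rational strictly between them exceeds c; it lies in [a,b[ because a itself is a
  -- member and hence a ≤ c.
  [,[-sup : ∀ {a b c} → a <ℝ b → (∀ {t} → t ∈ [ a , b [ → t ≤ℝ c) → b ≤ℝ c
  [,[-sup {a} {b} {c} a<b [a,b[≤c = ≮⇒≥ {c} {b} λ c<b → below c<b
    where
    below : ¬ c <ℝ b
    below c<b with <-dense {c} {b} c<b
    ... | r , c<r , r<b = <⇒≱ {c} {fromℚ r} c<r ([a,b[≤c {fromℚ r} (a≤r , r<b))
      where
      a≤r : a ≤ℝ fromℚ r
      a≤r q∈a = <⇒≤ {c} {fromℚ r} c<r ([a,b[≤c {a} ((λ p → p) , a<b) q∈a)

  -- Components

  -- A `Subset` is a predicate on cuts and need not respect equality of reals, which is mutual `≤ℝ`;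
  -- `resp` demands this of `A`.
  module Components (A : Subset) (resp : ∀ {x y} → x ≤ℝ y → y ≤ℝ x → x ∈ A → y ∈ A) where

    -- Vacuous when y < x, so asking for both directions covers either order of the two points.
    Joined : ℝ → ℝ → Set₁
    Joined x y = ∀ {z} → x ≤ℝ z → z ≤ℝ y → z ∈ A

    abstract

      -- Joined t y × Joined y t lives in Set₁; excluded middle brings it down to Set.
      comp : ℝ → Subset
      comp t y = True (em {Joined t y × Joined y t})

      comp⁺ : ∀ {t y} → Joined t y → Joined y t → y ∈ comp t
      comp⁺ {t} {y} ty yt = fromWitness {a? = em {Joined t y × Joined y t}} (ty , yt)

      comp⁻ : ∀ {t y} → y ∈ comp t → Joined t y × Joined y t
      comp⁻ {t} {y} = toWitness {a? = em {Joined t y × Joined y t}}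

    comp-trans : ∀ {x y z} → y ∈ comp x → z ∈ comp y → z ∈ comp x
    comp-trans {x} {y} {z} y∈x z∈y = comp⁺ (joined {x} {y} {z} xy yz) (joined {z} {y} {x} zy yx)
      where
      xy = proj₁ (comp⁻ y∈x)
      yx = proj₂ (comp⁻ y∈x)
      yz = proj₁ (comp⁻ z∈y)
      zy = proj₂ (comp⁻ z∈y)
      joined : ∀ {x y z} → Joined x y → Joined y z → Joined x z
      -- No order among x, y, z is assumed: w is on one side of y, and the hypothesis for that side
      -- applies.
      joined {y = y} xy yz {w} x≤w w≤z with ≤ℝ-total w y
      ... | inj₁ w≤y = xy x≤w w≤y
      ... | inj₂ y≤w = yz y≤w w≤z

    comp⊆A : ∀ {t} → comp t ⊆ A
    comp⊆A {t} {y} y∈t with comp⁻ y∈t | ≤ℝ-total t y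
    ... | ty , _ | inj₁ t≤y = ty t≤y (λ q → q)
    ... | _ , yt | inj₂ y≤t = yt (λ q → q) y≤t

    comp-interval : ∀ {t} → IsInterval (comp t)
    comp-interval x∈t z∈t x≤y y≤z =
      let _ , xt = comp⁻ x∈t
          tz , _ = comp⁻ z∈t
      in comp⁺ (λ t≤w w≤y → tz t≤w (λ q → y≤z (w≤y q)))
               (λ y≤w w≤t → xt (λ q → y≤w (x≤y q)) w≤t)

    interval⊆comp : ∀ {I t} → IsInterval I → I ⊆ A → t ∈ I → I ⊆ comp t
    interval⊆comp interval I⊆A t∈I y∈I =
      comp⁺ (λ t≤w w≤y → I⊆A (interval t∈I y∈I t≤w w≤y))
            (λ y≤w w≤t → I⊆A (interval y∈I t∈I y≤w w≤t))

    comp-refl : ∀ {t} → t ∈ A → t ∈ comp t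
    comp-refl t∈A = comp⁺ (λ t≤w w≤t → resp t≤w w≤t t∈A) (λ t≤w w≤t → resp t≤w w≤t t∈A)

    -- A point z between x and y outside `A` would separate K into the open rays below and above z.
    connected⇒joined : ∀ {K x y} → K ⊆ A → Connected K → x ∈ K → y ∈ K → Joined x y
    connected⇒joined {K} {x} {y} K⊆A connected x∈K y∈K {z} x≤z z≤y =
      decidable-stable (em₀ (A z)) λ z∉A →
        connected {_<ℝ z} {z <ℝ_} (λ {w} → open-below z {w}) (λ {w} → open-above z {w}) (λ w∈K → cover z∉A w∈K)
          (x , x∈K , x<z z∉A) (y , y∈K , z<y z∉A) λ w (_ , w<z , z<w) → <⇒≱ {w} {z} w<z (<⇒≤ {z} {w} z<w)
      where
      x<z : z ∉ A → x <ℝ z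
      x<z z∉A with <-≤-connex x z
      ... | inj₁ x<z = x<z
      ... | inj₂ z≤x = contradiction (resp x≤z z≤x (K⊆A x∈K)) z∉A
      z<y : z ∉ A → z <ℝ y
      z<y z∉A with <-≤-connex z y
      ... | inj₁ z<y = z<y
      ... | inj₂ y≤z = contradiction (resp y≤z z≤y (K⊆A y∈K)) z∉A
      cover : ∀ {w} → z ∉ A → w ∈ K → w <ℝ z ⊎ z <ℝ w
      cover {w} z∉A w∈K with <-≤-connex w z | <-≤-connex z w
      ... | inj₁ w<z | _        = inj₁ w<z
      ... | inj₂ _   | inj₁ z<w = inj₂ z<w
      ... | inj₂ z≤w | inj₂ w≤z = contradiction (resp w≤z z≤w (K⊆A w∈K)) z∉A

    connected⊆comp : ∀ {K t} → K ⊆ A → Connected K → t ∈ K → K ⊆ comp t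
    connected⊆comp {K} K⊆A connected t∈K y∈K =
      comp⁺ (connected⇒joined {K} K⊆A connected t∈K y∈K) (connected⇒joined {K} K⊆A connected y∈K t∈K)

    comp-isComponent : ∀ {t} → t ∈ A → IsComponent A (comp t)
    comp-isComponent {t} t∈A = (t , comp-refl t∈A) , comp⊆A , interval⇒connected {comp t} comp-interval ,
      λ {K′} K′⊆A connected comp⊆K′ → connected⊆comp {K′} K′⊆A connected (comp⊆K′ (comp-refl t∈A))

    -- Connectedness puts K inside the class of t; the class is an interval, hence connected, so
    -- maximality of K gives the converse.
    component≐comp : ∀ {K t} → IsComponent A K → t ∈ K → K ≐ comp t
    component≐comp {K} {t} (_ , K⊆A , connected , maximal) t∈K = K⊆comp ,
      maximal {comp t} comp⊆A (interval⇒connected {comp t} comp-interval) K⊆comp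
      where
      K⊆comp : K ⊆ comp t
      K⊆comp = connected⊆comp {K} K⊆A connected t∈K

  [_,_[ℚ : ℚ → ℚ → Subset
  [ a , b [ℚ = [ fromℚ a , fromℚ b [

  -- Lattices

  floor⇒∈[,[ : ∀ n k t → IsFloor (ℕ.suc k · t) (+ n) → t ∈ [ n ÷ k , ℕ.suc n ÷ k [ℚ
  floor⇒∈[,[ n k t (n≤kt , kt<1+n) = ≤·⇒÷≤ n k t n≤kt , ·<⇒<÷ (ℕ.suc n) k t kt<1+n

  ∈[,[⇒floor : ∀ n k t → t ∈ [ n ÷ k , ℕ.suc n ÷ k [ℚ → IsFloor (ℕ.suc k · t) (+ n)
  ∈[,[⇒floor n k t (n÷k≤t , t<1+n÷k) = ÷≤⇒≤· n k t n÷k≤t , <÷⇒·< (ℕ.suc n) k t t<1+n÷k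

  0∈Lattice : ∀ t → 0 ∈ Lattice t
  0∈Lattice t = 0 , floor-0

  floor-between : ∀ k n {x y z} → x ≤ℝ y → y ≤ℝ z →
                  IsFloor (k · x) (+ n) → IsFloor (k · z) (+ n) → IsFloor (k · y) (+ n)
  floor-between k n {x} {y} {z} x≤y y≤z (n≤kx , _) (_ , kz<1+n) =
    (λ q → ·-monoʳ-≤ k {x} {y} x≤y (n≤kx q)) ,
    ≤-<-trans {k · y} {k · z} {fromℤ (+ ℕ.suc n)} (·-monoʳ-≤ k {y} {z} y≤z) kz<1+n

  Lattice-resp : ∀ {x y n} → x ≤ℝ y → y ≤ℝ x → n ∈ Lattice x → n ∈ Lattice y
  Lattice-resp {x} {y} {n} x≤y y≤x (k , floor) = k , floor-between k n {x} {y} {x} x≤y y≤x floor floor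

  -- From 1 < (n+1)/(k+1), the multiplier k+1 is at most n. This leaves finitely many denominators,
  -- and is absurd for n = 0.
  <1+n÷k⇒k<n : ∀ n k {t} → 1ℝ ≤ℝ t → t <ℝ fromℚ (ℕ.suc n ÷ k) → k ℕ.< n
  <1+n÷k⇒k<n n k {t} 1≤t t<1+n÷k = ℕ.s≤s⁻¹ (subst₂ ℕ._<_ (ℕ.+-identityʳ (ℕ.suc k)) (ℕ.*-identityʳ (ℕ.suc n))
    (÷-cancel-< 1 0 (ℕ.suc n) k (fromℚ-cancel-< (≤-<-trans {1ℝ} {t} {fromℚ (ℕ.suc n ÷ k)} 1≤t t<1+n÷k))))

  p<q+r⇒p-r<q : ∀ {p} q r → p ℚ.< q ℚ.+ r → p ℚ.- r ℚ.< q
  p<q+r⇒p-r<q {p} q r p<q+r = subst (p ℚ.- r ℚ.<_)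
    (trans (ℚ.+-assoc q r (ℚ.- r)) (trans (cong (q ℚ.+_) (ℚ.+-inverseʳ r)) (ℚ.+-identityʳ q)))
    (ℚ.+-monoˡ-< (ℚ.- r) p<q+r)

  p-r<q⇒p<r+q : ∀ {p q} r → p ℚ.- r ℚ.< q → p ℚ.< r ℚ.+ q
  p-r<q⇒p<r+q {p} {q} r p-r<q = subst (ℚ._< r ℚ.+ q) (p+[q-p]≡q r p) (ℚ.+-monoʳ-< r p-r<q)

  1+≤+ : ∀ n t x → 1ℝ ≤ℝ t → fromℤ (+ n) ≤ℝ x → fromℤ (+ ℕ.suc n) ≤ℝ t +ℝ x
  1+≤+ n t x 1≤t n≤x {q} q<1+n =
    let q-n<1 = p<q+r⇒p-r<q 1ℚ (n ÷ 0) (subst (q ℚ.<_) (÷0-suc n) q<1+n)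
        -- Choosing r between q - n and 1 puts r below t and leaves q - r below n, hence below x.
        r , q-n<r , r<1 = ℚ.<-dense q-n<1
        q-r<n = p<q+r⇒p-r<q (n ÷ 0) r (p-r<q⇒p<r+q {q} (n ÷ 0) q-n<r)
    in r , q ℚ.- r , 1≤t r<1 , n≤x q-r<n , sym (p+[q-p]≡q r q)

  -- For q < n, write 1 + q as r + s with r below t and s below x; then r < 1, so s cannot be
  -- smaller than q.
  1+≤+⇒≤ : ∀ n t x → t ≤ℝ 1ℝ → fromℤ (+ ℕ.suc n) ≤ℝ t +ℝ x → fromℤ (+ n) ≤ℝ x
  1+≤+⇒≤ n t x t≤1 1+n≤t+x {q} q<n
    with 1+n≤t+x (subst (1ℚ ℚ.+ q ℚ.<_) (sym (÷0-suc n)) (ℚ.+-monoʳ-< 1ℚ q<n))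
  ... | r , s , r∈t , s∈x , 1+q≡r+s = downward-≤ x (ℚ.≮⇒≥ λ s<q →
    ℚ.<-irrefl (sym 1+q≡r+s) (ℚ.+-mono-< (t≤1 r∈t) s<q)) s∈x

  jump : ∀ n j t → 1ℝ ≤ℝ t → fromℤ (+ n) ≤ℝ j · t → ∀ d → fromℤ (+ (d ℕ.+ n)) ≤ℝ (d ℕ.+ j) · t
  jump n j t 1≤t n≤jt ℕ.zero    = n≤jt
  jump n j t 1≤t n≤jt (ℕ.suc d) = 1+≤+ (d ℕ.+ n) t ((d ℕ.+ j) · t) 1≤t (jump n j t 1≤t n≤jt d)

  -- Each step adds at least 1, so [n,n+1[ contains at most one multiple of t.
  one-multiple-per-unit : ∀ n j {k} t → 1ℝ ≤ℝ t → j ℕ.< k →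
                          fromℤ (+ n) ≤ℝ j · t → ¬ k · t <ℝ fromℤ (+ ℕ.suc n)
  one-multiple-per-unit n j t 1≤t j<k n≤jt kt<1+n with ℕ.m≤n⇒∃[o]m+o≡n j<k
  ... | d , refl = <⇒≱ {ℕ.suc (j ℕ.+ d) · t} {fromℤ (+ ℕ.suc n)} kt<1+n
    λ q<1+n → subst (λ m → fromℤ (+ ℕ.suc n) ≤ℝ ℕ.suc m · t) (ℕ.+-comm d j)
      (λ p<1+n → jump n j t 1≤t n≤jt (ℕ.suc d)
        (fromℤ-mono-≤ {ℕ.suc n} {ℕ.suc d ℕ.+ n} (ℕ.s≤s (ℕ.m≤n+m n d)) p<1+n))
      q<1+n

  -- Descending from a known upper bound finds the floor and also records m < n, which `same-floor`
  -- needs.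
  floor-below : ∀ x → 0ℝ ≤ℝ x → ∀ n → x <ℝ fromℤ (+ n) → ∃ λ m → m ℕ.< n × IsFloor x (+ m)
  floor-below x 0≤x ℕ.zero    x<0   = contradiction (λ {q} → 0≤x {q}) (<⇒≱ {x} {0ℝ} x<0)
  floor-below x 0≤x (ℕ.suc n) x<1+n with <-≤-connex x (fromℤ (+ n))
  ... | inj₂ n≤x = n , ℕ.n<1+n n , n≤x , x<1+n
  ... | inj₁ x<n = let m , m<n , floor = floor-below x 0≤x n x<n in m , ℕ.m<n⇒m<1+n m<n , floor

  ·-nonneg : ∀ k t → 0ℝ <ℝ t → 0ℝ ≤ℝ k · t
  ·-nonneg ℕ.zero    t 0<t = λ q<0 → q<0
  ·-nonneg (ℕ.suc k) t 0<t = ÷≤⇒≤· 0 k t λ q<0÷k →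
    <⇒≤ {0ℝ} {t} 0<t (ℚ.<-≤-trans q<0÷k (÷-mono-≤ 0 k 0 0 ℕ.z≤n))

  archimedean : ∀ t → 0ℝ <ℝ t → ∀ n → ∃ λ k → fromℤ (+ n) ≤ℝ k · t
  -- The rational q may be 0; a larger element r of the cut is positive.
  archimedean t (q , q≮0 , q∈t) n with rounded t q∈t
  ... | r , q<r , r∈t = found r (ℚ.positive (ℚ.≤-<-trans (ℚ.≮⇒≥ q≮0) q<r)) r∈t
    where
    found : ∀ r → ℚ.Positive r → r ∈ lower t → ∃ λ k → fromℤ (+ n) ≤ℝ k · t
    found r@(ℚ.mkℚ (+ ℕ.suc p) d _) _ r∈t = ℕ.suc k , ÷≤⇒≤· n k t λ q<n÷k →
      downward-≤ t (ℚ.≤-trans (ℚ.<⇒≤ q<n÷k) n÷k≤r) r∈t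
      where
      -- With this k, n/(k+1) ≤ 1/(d+1) ≤ r.
      k = n ℕ.* ℕ.suc d
      n÷k≤r : n ÷ k ℚ.≤ r
      n÷k≤r = subst (n ÷ k ℚ.≤_) (ℚ.↥p/↧p≡p r)
        (÷-mono-≤ n k (ℕ.suc p) d (ℕ.≤-trans (ℕ.n≤1+n k) (ℕ.m≤m+n (ℕ.suc k) (p ℕ.* ℕ.suc k))))

  -- A step of length at most 1 cannot jump over the unit interval above n.
  ≤1⇒∈Lattice : ∀ t → 0ℝ <ℝ t → t ≤ℝ 1ℝ → ∀ n → n ∈ Lattice t
  ≤1⇒∈Lattice t 0<t t≤1 n = let k , 1+n≤kt = archimedean t 0<t (ℕ.suc n) in descend k 1+n≤kt
    where
    descend : ∀ k → fromℤ (+ ℕ.suc n) ≤ℝ k · t → n ∈ Lattice t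
    descend ℕ.zero    1+n≤0 = contradiction (λ {q} → 1+n≤0 {q})
      (<⇒≱ {0ℝ} {fromℤ (+ ℕ.suc n)} (fromℤ-mono-< {0} {ℕ.suc n} ℕ.z<s))
    descend (ℕ.suc k) 1+n≤t+kt with <-≤-connex (k · t) (fromℤ (+ ℕ.suc n))
    ... | inj₁ kt<1+n = k , 1+≤+⇒≤ n t (k · t) t≤1 1+n≤t+kt , kt<1+n
    ... | inj₂ 1+n≤kt = descend k 1+n≤kt

  -- Rational cells

  filtered-max : ∀ (P : Pred ℚ (suc 0ℓ)) qs → (∃ λ q → q List.∈ qs × P q) →
                 ∃ λ q → q List.∈ qs × P q × (∀ {r} → r List.∈ qs → P r → r ℚ.≤ q)
  filtered-max P qs (q , q∈qs , Pq) =
    -- The given q is the default value of `max`, so the maximum satisfies P along with the filtered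
    -- elements.
    let m∈qs , Pm = argmax-all id {λ q → q List.∈ qs × P q} (q∈qs , Pq) (tabulate λ q∈ → ∈-filter⁻ P? q∈)
    in max q (filter P? qs) , m∈qs , Pm , λ r∈qs Pr → lookup (xs≤max q (filter P? qs)) (∈-filter⁺ P? r∈qs Pr)
    where
    P? : ∀ q → Dec (P q)
    P? q = em

  filtered-min : ∀ (P : Pred ℚ (suc 0ℓ)) qs → (∃ λ q → q List.∈ qs × P q) →
                 ∃ λ q → q List.∈ qs × P q × (∀ {r} → r List.∈ qs → P r → q ℚ.≤ r)
  filtered-min P qs (q , q∈qs , Pq) =
    let m∈qs , Pm = argmin-all id {P = λ q → q List.∈ qs × P q} (q∈qs , Pq) (tabulate λ q∈ → ∈-filter⁻ P? q∈)
    in min q (filter P? qs) , m∈qs , Pm , λ r∈qs Pr → lookup (min≤xs q (filter P? qs)) (∈-filter⁺ P? r∈qs Pr)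
    where
    P? : ∀ q → Dec (P q)
    P? q = em

  abstract

    -- The fractions p/d with p ≤ m+1 and 1 ≤ d ≤ m; the numerator m+1 is needed for the right end
    -- of the cell of the value m.
    grid : ℕ → List ℚ
    grid m = cartesianProductWith _÷_ (upTo (ℕ.suc (ℕ.suc m))) (upTo m)

    ∈-grid⁺ : ∀ {m} p k → p ℕ.≤ ℕ.suc m → k ℕ.< m → p ÷ k List.∈ grid m
    ∈-grid⁺ p k p≤1+m k<m = ∈-cartesianProductWith⁺ _÷_ (∈-upTo⁺ (ℕ.s≤s p≤1+m)) (∈-upTo⁺ k<m)

    ∈-grid⁻ : ∀ {m q} → q List.∈ grid m → ∃₂ λ p k → k ℕ.< m × q ≡ p ÷ k
    ∈-grid⁻ {m} q∈grid =
      let p , k , _ , k∈upTo , q≡p÷k = ∈-cartesianProductWith⁻ _÷_ (upTo (ℕ.suc (ℕ.suc m))) (upTo m) q∈grid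
      in p , k , ∈-upTo⁻ k∈upTo , q≡p÷k

  grid-gap : ∀ {m a b} .{{_ : ℕ.NonZero m}} → a List.∈ grid m → b List.∈ grid m →
             a ℚ.< b → a ℚ.+ 1/ m ² ℚ.≤ b
  grid-gap {m} a∈grid b∈grid a<b with ∈-grid⁻ a∈grid | ∈-grid⁻ b∈grid
  ... | p , k , k<m , refl | q , l , l<m , refl = ÷-gap p k q l m k<m l<m a<b

  -- Intersecting two cells around t takes the larger left end and the smaller right end, so
  -- conditions can be combined without leaving the grid.
  GridCell : ℕ → Subset → ℝ → Set₁
  GridCell m P t = ∃₂ λ a b → a List.∈ grid m × b List.∈ grid m × t ∈ [ a , b [ℚ × [ a , b [ℚ ⊆ P

  GridCell-∩ : ∀ {m P Q t} → GridCell m P t → GridCell m Q t → GridCell m (P ∩ Q) t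
  GridCell-∩ {m} {P} {Q} {t} (a , b , a∈ , b∈ , (a≤t , t<b) , sub) (c , d , c∈ , d∈ , (c≤t , t<d) , sub′) =
    a ℚ.⊔ c , b ℚ.⊓ d , a⊔c∈ , b⊓d∈ , (a⊔c≤t , t<b⊓d) , λ {s} s∈ → sub (left s s∈) , sub′ (right s s∈)
    where
    a⊔c∈ : a ℚ.⊔ c List.∈ grid m
    a⊔c∈ with ℚ.⊔-sel a c
    ... | inj₁ eq = subst (List._∈ grid m) (sym eq) a∈
    ... | inj₂ eq = subst (List._∈ grid m) (sym eq) c∈
    b⊓d∈ : b ℚ.⊓ d List.∈ grid m
    b⊓d∈ with ℚ.⊓-sel b d
    ... | inj₁ eq = subst (List._∈ grid m) (sym eq) b∈
    ... | inj₂ eq = subst (List._∈ grid m) (sym eq) d∈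
    a⊔c≤t : fromℚ (a ℚ.⊔ c) ≤ℝ t
    a⊔c≤t with ℚ.⊔-sel a c
    ... | inj₁ eq = subst (λ q → fromℚ q ≤ℝ t) (sym eq) a≤t
    ... | inj₂ eq = subst (λ q → fromℚ q ≤ℝ t) (sym eq) c≤t
    t<b⊓d : t <ℝ fromℚ (b ℚ.⊓ d)
    t<b⊓d with ℚ.⊓-sel b d
    ... | inj₁ eq = subst (λ q → t <ℝ fromℚ q) (sym eq) t<b
    ... | inj₂ eq = subst (λ q → t <ℝ fromℚ q) (sym eq) t<d
    left : ∀ s → s ∈ [ a ℚ.⊔ c , b ℚ.⊓ d [ℚ → s ∈ [ a , b [ℚ
    left s (lo , hi) = (λ p → lo (fromℚ-mono-≤ (ℚ.p≤p⊔q a c) p)) ,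
      <-≤-trans {s} {fromℚ (b ℚ.⊓ d)} {fromℚ b} hi (fromℚ-mono-≤ (ℚ.p⊓q≤p b d))
    right : ∀ s → s ∈ [ a ℚ.⊔ c , b ℚ.⊓ d [ℚ → s ∈ [ c , d [ℚ
    right s (lo , hi) = (λ p → lo (fromℚ-mono-≤ (ℚ.p≤q⊔p a c) p)) ,
      <-≤-trans {s} {fromℚ (b ℚ.⊓ d)} {fromℚ d} hi (fromℚ-mono-≤ (ℚ.p⊓q≤q b d))

  -- The floor of the (k+1)-fold multiple is n exactly on [n/(k+1),(n+1)/(k+1)[. The multiplier 0 is
  -- ruled out by n ≠ 0, and t ≥ 1 bounds the denominator.
  Lattice-cell : ∀ {m n t} → n ℕ.≤ m → n ≢ 0 → 1ℝ ≤ℝ t → n ∈ Lattice t → GridCell m (λ s → n ∈ Lattice s) t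
  Lattice-cell {n = n} n≤m n≢0 1≤t (ℕ.zero , floor) = contradiction (floor-unique 0ℝ {n} {0} floor floor-0) n≢0
  Lattice-cell {m} {n} {t} n≤m n≢0 1≤t (ℕ.suc k , floor) =
    n ÷ k , ℕ.suc n ÷ k , ∈-grid⁺ n k (ℕ.m≤n⇒m≤1+n n≤m) k<m , ∈-grid⁺ (ℕ.suc n) k (ℕ.s≤s n≤m) k<m ,
    t∈cell , λ {s} s∈cell → ℕ.suc k , ∈[,[⇒floor n k s s∈cell
    where
    t∈cell : t ∈ [ n ÷ k , ℕ.suc n ÷ k [ℚ
    t∈cell = floor⇒∈[,[ n k t floor
    k<m : k ℕ.< m
    k<m = ℕ.<-≤-trans (<1+n÷k⇒k<n n k {t} 1≤t (proj₂ t∈cell)) n≤m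

  GridCell-map : ∀ {m P Q} t → P ⊆ Q → GridCell m P t → GridCell m Q t
  GridCell-map t P⊆Q (a , b , a∈ , b∈ , t∈ , sub) = a , b , a∈ , b∈ , t∈ , λ {s} s∈ → P⊆Q (sub s∈)

  Lattices-cell : ∀ {m t} S → (∀ {n} → n List.∈ S → n ℕ.≤ m) → 1ℝ ≤ℝ t → t <ℝ fromℤ (+ ℕ.suc m) → 1 ℕ.≤ m →
                  ⟦ S ⟧ ⊆ Lattice t → GridCell m ((λ s → ⟦ S ⟧ ⊆ Lattice s) ∩ [ 1ℝ ,+∞[) t
  Lattices-cell {m} {t} [] S≤m 1≤t t<1+m 1≤m S⊆t =
    -- The cell of the empty list is [1,m+1[; its left end keeps every later intersection above 1.
    1 ÷ 0 , ℕ.suc m ÷ 0 , ∈-grid⁺ 1 0 (ℕ.s≤s ℕ.z≤n) 1≤m , ∈-grid⁺ (ℕ.suc m) 0 ℕ.≤-refl 1≤m ,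
    (1≤t , t<1+m) , λ (1≤s , _) → (λ ()) , 1≤s
  Lattices-cell {m} {t} (n ∷ S) S≤m 1≤t t<1+m 1≤m S⊆t =
    cons (n ℕ.≟ 0) (Lattices-cell S (λ n∈S → S≤m (there n∈S)) 1≤t t<1+m 1≤m (λ n∈S → S⊆t (there n∈S)))
    where
    Compat : List ℕ → Subset
    Compat S = (λ s → ⟦ S ⟧ ⊆ Lattice s) ∩ [ 1ℝ ,+∞[
    cons : Dec (n ≡ 0) → GridCell m (Compat S) t → GridCell m (Compat (n ∷ S)) t
    cons (yes refl) = GridCell-map {P = Compat S} {Compat (n ∷ S)} t λ {s} (S⊆s , 1≤s) →
      (λ { (here refl) → 0∈Lattice s ; (there n∈S) → S⊆s n∈S }) , 1≤s
    cons (no n≢0) cell = GridCell-map {P = (λ s → n ∈ Lattice s) ∩ Compat S} {Compat (n ∷ S)} t (λ (n∈s , S⊆s , 1≤s) →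
      (λ { (here refl) → n∈s ; (there n∈S) → S⊆s n∈S }) , 1≤s)
      (GridCell-∩ {t = t} (Lattice-cell (S≤m (here refl)) n≢0 1≤t (S⊆t (here refl))) cell)

  [,[-length : ∀ {K a b δ} → K ≐ [ a , b [ℚ → fromℚ a <ℝ fromℚ b → a ℚ.+ δ ℚ.≤ b → LengthAtLeast δ K
  [,[-length {K} {a} {b} (K⊆[a,b[ , [a,b[⊆K) a<b a+δ≤b = fromℚ a , fromℚ b ,
    ((λ s∈K → proj₁ (K⊆[a,b[ s∈K)) , λ below → below ([a,b[⊆K {fromℚ a} ((λ q → q) , a<b))) ,
    ((λ {s} s∈K → <⇒≤ {s} {fromℚ b} (proj₂ (K⊆[a,b[ s∈K))) ,
     λ {c} above → [,[-sup {fromℚ a} {fromℚ b} {c} a<b λ {s} s∈ → above ([a,b[⊆K {s} s∈)) ,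
    λ { (r , s , r<a , s<δ , refl) → ℚ.<-≤-trans (ℚ.+-mono-< r<a s<δ) a+δ≤b }

  -- Components of a set covered by grid cells

  module GridComponents (A : Subset) (A-resp : ∀ {x y} → x ≤ℝ y → y ≤ℝ x → x ∈ A → y ∈ A)
                        (m : ℕ) (A-cell : ∀ {t} → t ∈ A → GridCell m A t) where

    open Components A A-resp public

    [,[⊆comp : ∀ a b {t} → [ a , b [ ⊆ A → t ∈ [ a , b [ → [ a , b [ ⊆ comp t
    [,[⊆comp a b {t} = interval⊆comp {[ a , b [} {t} λ {x} {y} {z} → [,[-interval a b {x} {y} {z}

    cell⊆comp : ∀ {x t a b} → x ∈ comp t → [ a , b [ℚ ⊆ A → x ∈ [ a , b [ℚ → [ a , b [ℚ ⊆ comp t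
    cell⊆comp {x} {t} {a} {b} x∈t sub x∈ y∈ =
      comp-trans x∈t ([,[⊆comp (fromℚ a) (fromℚ b) sub x∈ y∈)

    -- The left end is the least grid point in the class. The right end lies outside the class, so
    -- it is taken as the greatest grid point b with [y,b[ inside `A` for some y < b of the class.
    -- The cell around any point of the class supplies competitors for both.
    comp≐[,[ : ∀ {t} → t ∈ A → ∃₂ λ a b → a List.∈ grid m × b List.∈ grid m × comp t ≐ [ a , b [ℚ
    comp≐[,[ {t} t∈A with A-cell t∈A
    ... | a₀ , b₀ , a₀∈ , b₀∈ , t∈@(a₀≤t , t<b₀) , sub₀
      with filtered-min (λ a → Lift (suc 0ℓ) (fromℚ a ∈ comp t)) (grid m)
             (a₀ , a₀∈ , lift (cell⊆comp (comp-refl t∈A) sub₀ t∈ ((λ q → q) , a₀<b₀)))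
         | filtered-max (λ b → ∃ λ y → y ∈ comp t × y <ℝ fromℚ b × [ y , fromℚ b [ ⊆ A) (grid m)
             (b₀ , b₀∈ , t , comp-refl t∈A , t<b₀ , λ {s} (t≤s , s<b₀) → sub₀ ((λ q → t≤s (a₀≤t q)) , s<b₀))
      where
      a₀<b₀ : fromℚ a₀ <ℝ fromℚ b₀
      a₀<b₀ = ≤-<-trans {fromℚ a₀} {t} {fromℚ b₀} a₀≤t t<b₀
    ... | a , a∈ , lift a∈t , a-min | b , b∈ , (y , y∈t , y<b , [y,b[⊆A) , b-max =
      a , b , a∈ , b∈ , comp⊆[a,b[ , λ {s} → [a,b[⊆comp {s}
      where
      comp⊆[a,b[ : comp t ⊆ [ a , b [ℚ
      comp⊆[a,b[ {s} s∈t with A-cell (comp⊆A s∈t)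
      ... | c , d , c∈ , d∈ , s∈@(c≤s , s<d) , sub =
        (λ q → c≤s (fromℚ-mono-≤ (a-min c∈ (lift (cell⊆comp s∈t sub s∈ ((λ q → q) , c<d)))) q)) ,
        <-≤-trans {s} {fromℚ d} {fromℚ b} s<d (fromℚ-mono-≤ (b-max d∈
          (s , s∈t , s<d , λ {w} (s≤w , w<d) → sub ((λ q → s≤w (c≤s q)) , w<d))))
        where
        c<d : fromℚ c <ℝ fromℚ d
        c<d = ≤-<-trans {fromℚ c} {s} {fromℚ d} c≤s s<d
      [a,b[⊆comp : [ a , b [ℚ ⊆ comp t
      [a,b[⊆comp {s} (a≤s , s<b) with ≤ℝ-total s y
      ... | inj₁ s≤y = comp-interval a∈t y∈t a≤s s≤y
      ... | inj₂ y≤s = comp-trans y∈t ([,[⊆comp y (fromℚ b) [y,b[⊆A ((λ q → q) , y<b) (y≤s , s<b))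

    component≐[,[ : ∀ {K t} → IsComponent A K → t ∈ K →
                    ∃₂ λ a b → a List.∈ grid m × b List.∈ grid m × K ≐ [ a , b [ℚ
    component≐[,[ {K} comp-K@(_ , K⊆A , _) t∈K =
      let a , b , a∈ , b∈ , eq = comp≐[,[ (K⊆A t∈K)
      in a , b , a∈ , b∈ , ≐-trans {i = K} (component≐comp comp-K t∈K) eq

    component-interval : ∀ {K} → IsComponent A K → IsInterval K
    component-interval {K} comp-K@((t , t∈K) , _) x∈K z∈K x≤y y≤z =
      let K⊆comp , comp⊆K = component≐comp {K} comp-K t∈K
      in comp⊆K (comp-interval (K⊆comp x∈K) (K⊆comp z∈K) x≤y y≤z)

    component-length : .{{_ : ℕ.NonZero m}} → ∀ {K} → IsComponent A K → LengthAtLeast (1/ m ²) K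
    component-length {K} comp-K@((t , t∈K) , _) =
      let a , b , a∈ , b∈ , K≐[a,b[ = component≐[,[ {K} comp-K t∈K
          a≤t , t<b = proj₁ K≐[a,b[ t∈K
          a<b = ≤-<-trans {fromℚ a} {t} {fromℚ b} a≤t t<b
      in [,[-length {K} K≐[a,b[ a<b (grid-gap a∈ b∈ (fromℚ-cancel-< a<b))

    -- The set C is kept apart from `A` because the supremum in `IsTopComponent` is that of `𝒞 S`,
    -- not of its part above 1.
    HasTop : Subset → Subset → Set₁
    HasTop C K = IsComponent A K × ∃₂ λ a b → K ≐ [ a , b [ × IsSup C b

    -- The right ends of components are grid points, so there is a greatest one; it bounds `A`, as
    -- each point lies below the right end of its own class.
    top-exists : ∀ {t} → t ∈ A → ∃ (HasTop A)
    top-exists {t} t∈A =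
      let a , b , _ , b∈ , comp≐ = comp≐[,[ t∈A
      in last-component (filtered-max End (grid m) (b , b∈ , t , a , t∈A , comp≐))
      where
      End : Pred ℚ (suc 0ℓ)
      End b = ∃₂ λ t a → t ∈ A × comp t ≐ [ a , b [ℚ

      last-component : (∃ λ b → b List.∈ grid m × End b × (∀ {c} → c List.∈ grid m → End c → c ℚ.≤ b)) →
                       ∃ (HasTop A)
      last-component (b , _ , (t , a , t∈A , comp≐@(comp⊆ , ⊆comp)) , b-max) =
        comp t , comp-isComponent t∈A , fromℚ a , fromℚ b , comp≐ , (λ {s} → A≤b {s}) , λ {c} above →
          [,[-sup {fromℚ a} {fromℚ b} {c} a<b λ {s} s∈ → above (comp⊆A (⊆comp {s} s∈))
        where
        a<b : fromℚ a <ℝ fromℚ b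
        a<b = let a≤t , t<b = comp⊆ (comp-refl t∈A) in ≤-<-trans {fromℚ a} {t} {fromℚ b} a≤t t<b
        A≤b : ∀ {s} → s ∈ A → s ≤ℝ fromℚ b
        A≤b {s} s∈A q<s =
          let c , d , _ , d∈ , comp≐ = comp≐[,[ s∈A
          in fromℚ-mono-≤ (b-max d∈ (s , c , s∈A , comp≐))
               (<⇒≤ {s} {fromℚ d} (proj₂ (proj₁ comp≐ (comp-refl s∈A))) q<s)

    meeting-components : ∀ {K L t} → IsComponent A K → IsComponent A L → t ∈ K → t ∈ L → K ≐ L
    meeting-components {K} {L} {t} comp-K comp-L t∈K t∈L =
      let K⊆comp , comp⊆K = component≐comp {K} comp-K t∈K
          L⊆comp , comp⊆L = component≐comp {L} comp-L t∈L
      in (λ s∈K → comp⊆L (K⊆comp s∈K)) , (λ s∈L → comp⊆K (L⊆comp s∈L))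

    -- Both right ends are suprema of C, so the larger of two representatives lies in both
    -- components.
    top-unique : ∀ {C K L} → HasTop C K → HasTop C L → K ≐ L
    top-unique {C} {K} {L}
      (comp-K@((x , x∈K) , _) , a , b , (K⊆[a,b[ , [a,b[⊆K) , (C≤b , b-least))
      (comp-L@((y , y∈L) , _) , c , d , (L⊆[c,d[ , [c,d[⊆L) , (C≤d , d-least)) with ≤ℝ-total x y
    ... | inj₁ x≤y = meeting-components {K} {L} comp-K comp-L
      ([a,b[⊆K ((λ q → x≤y (proj₁ (K⊆[a,b[ x∈K) q)) ,
                <-≤-trans {y} {d} {b} (proj₂ (L⊆[c,d[ y∈L)) (d-least {b} λ {t} → C≤b {t})))
      y∈L
    ... | inj₂ y≤x = meeting-components {K} {L} comp-K comp-L x∈K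
      ([c,d[⊆L ((λ q → y≤x (proj₁ (L⊆[c,d[ y∈L) q)) ,
                <-≤-trans {x} {b} {d} (proj₂ (K⊆[a,b[ x∈K)) (b-least {d} λ {t} → C≤d {t})))

    -- Compare τ with a point t of K. If τ ≤ t, the absence of gaps joins them; otherwise τ is below
    -- the right end of its own class, which is at most b.
    gap-free∈top : ∀ {C K τ} → A ⊆ C → τ ∈ A → (∀ {s t} → t ∈ A → τ ≤ℝ s → s ≤ℝ t → s ∈ A) →
                   HasTop C K → τ ∈ K
    gap-free∈top {C} {K} {τ} A⊆C τ∈A gap-free
      (comp-K@((t , t∈K) , K⊆A , _) , a , b , (K⊆[a,b[ , [a,b[⊆K) , (C≤b , _)) with ≤ℝ-total τ t
    ... | inj₁ τ≤t = proj₂ (component≐comp {K} comp-K t∈K) (comp⁺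
      (λ t≤w w≤τ → A-resp t≤w (λ q → τ≤t (w≤τ q)) (K⊆A t∈K))
      (λ τ≤w w≤t → gap-free (K⊆A t∈K) τ≤w w≤t))
    ... | inj₂ t≤τ =
      let c , d , _ , _ , comp⊆ , ⊆comp = comp≐[,[ τ∈A
          c≤τ , τ<d = comp⊆ (comp-refl τ∈A)
          d≤b = [,[-sup {fromℚ c} {fromℚ d} {b} (≤-<-trans {fromℚ c} {τ} {fromℚ d} c≤τ τ<d)
                  λ {s} s∈ → C≤b (A⊆C (comp⊆A (⊆comp {s} s∈)))
      in [a,b[⊆K ((λ q → t≤τ (proj₁ (K⊆[a,b[ t∈K) q)) , <-≤-trans {τ} {fromℚ d} {b} τ<d d≤b)

  -- The set of compatible numbers

  module Compatible (S : List ℕ) (x̂ : ℕ) (x̂-max : IsMax S x̂) (x̂≥1 : x̂ ≥ 1) where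

    A : Subset
    A = 𝒞 S ∩ [ 1ℝ ,+∞[

    1≤⇒0< : ∀ {t} → 1ℝ ≤ℝ t → 0ℝ <ℝ t
    1≤⇒0< {t} 1≤t = <-≤-trans {0ℝ} {1ℝ} {t} (fromℤ-mono-< {0} {1} ℕ.z<s) 1≤t

    A-resp : ∀ {x y} → x ≤ℝ y → y ≤ℝ x → x ∈ A → y ∈ A
    A-resp {x} {y} x≤y y≤x ((0<x , S⊆x) , 1≤x) =
      (<-≤-trans {0ℝ} {x} {y} 0<x x≤y , λ {n} n∈S → Lattice-resp {x} {y} {n} x≤y y≤x (S⊆x n∈S)) , λ q → x≤y (1≤x q)

    A-cell : ∀ {t} → t ∈ A → GridCell x̂ A t
    A-cell {t} ((0<t , S⊆t) , 1≤t) =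
      let a , b , a∈ , b∈ , t∈ , sub = Lattices-cell S (proj₂ x̂-max) 1≤t (t<1+x̂ (S⊆t (proj₁ x̂-max))) x̂≥1 S⊆t
      in a , b , a∈ , b∈ , t∈ , λ {s} s∈ → (1≤⇒0< {s} (proj₂ (sub {s} s∈)) , proj₁ (sub {s} s∈)) , proj₂ (sub {s} s∈)
      where
      -- As x̂ is nonzero its multiplier is at least 1, whence t < (x̂+1)/(k+1) ≤ x̂+1.
      t<1+x̂ : x̂ ∈ Lattice t → t <ℝ fromℤ (+ ℕ.suc x̂)
      t<1+x̂ (ℕ.zero , floor) = contradiction (floor-unique 0ℝ {x̂} {0} floor floor-0) (ℕ.m<n⇒n≢0 x̂≥1)
      t<1+x̂ (ℕ.suc k , floor) = <-≤-trans {t} {fromℚ (ℕ.suc x̂ ÷ k)} {fromℤ (+ ℕ.suc x̂)}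
        (proj₂ (floor⇒∈[,[ x̂ k t floor))
        (fromℚ-mono-≤ (÷-mono-≤ (ℕ.suc x̂) k (ℕ.suc x̂) 0 (ℕ.*-monoʳ-≤ (ℕ.suc x̂) (ℕ.s≤s ℕ.z≤n))))

    open GridComponents A A-resp x̂ A-cell public

    ]0,1]⊆𝒞 : ] 0ℝ , 1ℝ ] ⊆ 𝒞 S
    ]0,1]⊆𝒞 {t} (0<t , t≤1) = 0<t , λ {n} _ → ≤1⇒∈Lattice t 0<t t≤1 n

    𝒞≐]0,1]∪⋃components : 𝒞 S ≐ ] 0ℝ , 1ℝ ] ∪ ⋃Components A
    𝒞≐]0,1]∪⋃components = split , join
      where
      split : 𝒞 S ⊆ ] 0ℝ , 1ℝ ] ∪ ⋃Components A
      split {t} t∈𝒞 = at (≤ℝ-total t 1ℝ)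
        where
        at : t ≤ℝ 1ℝ ⊎ 1ℝ ≤ℝ t → t ∈ ] 0ℝ , 1ℝ ] ∪ ⋃Components A
        at (inj₁ t≤1) = inj₁ (proj₁ t∈𝒞 , t≤1)
        at (inj₂ 1≤t) = inj₂ (comp t , comp-isComponent (t∈𝒞 , 1≤t) , comp-refl (t∈𝒞 , 1≤t))
      join : ] 0ℝ , 1ℝ ] ∪ ⋃Components A ⊆ 𝒞 S
      join {t} (inj₁ t∈]0,1])              = ]0,1]⊆𝒞 {t} t∈]0,1]
      join (inj₂ (K , (_ , K⊆A , _) , t∈K)) = proj₁ (K⊆A t∈K)

    1∈A : 1ℝ ∈ A
    1∈A = ]0,1]⊆𝒞 {1ℝ} (1≤⇒0< {1ℝ} id , id) , id

    -- Points of `𝒞 S` that are at most 1 lie below 1 ∈ `A`, so every upper bound of `A` bounds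
    -- `𝒞 S`.
    topComponent : ∃ (IsTopComponent S)
    topComponent =
      let K , comp-K , a , b , K≐[a,b[ , A≤b , b-least = top-exists {1ℝ} 1∈A
      in K , comp-K , a , b , K≐[a,b[ , (λ {s} s∈𝒞 → 𝒞≤ b A≤b s∈𝒞 (≤ℝ-total s 1ℝ)) ,
         λ {c} above → b-least {c} λ (s∈𝒞 , _) → above s∈𝒞
      where
      𝒞≤ : ∀ b → (∀ {s} → s ∈ A → s ≤ℝ b) → ∀ {s} → s ∈ 𝒞 S → s ≤ℝ 1ℝ ⊎ 1ℝ ≤ℝ s → s ≤ℝ b
      𝒞≤ b A≤b s∈𝒞 (inj₁ s≤1) q<s = A≤b {1ℝ} 1∈A (s≤1 q<s)
      𝒞≤ b A≤b s∈𝒞 (inj₂ 1≤s)     = A≤b (s∈𝒞 , 1≤s)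

    -- Samples without outliers or missing values

    module NoGaps (τ : ℝ) (1≤τ : 1ℝ ≤ℝ τ) (noOutliers : NoOutliers S τ) (noMissing : NoMissingValues S τ) where

      τ∈A : τ ∈ A
      τ∈A = (1≤⇒0< {τ} 1≤τ , noOutliers) , 1≤τ

      small∈S : ∀ n → n ∈ Lattice τ → n ≢ 0 → n ℕ.≤ x̂ → n ∈ ⟦ S ⟧
      small∈S n n∈τ n≢0 n≤x̂ with ℕ.m≤n⇒m<n∨m≡n n≤x̂
      ... | inj₁ n<x̂  = noMissing x̂-max n∈τ n≢0 n<x̂
      ... | inj₂ refl = proj₁ x̂-max

      -- The value n = ⌊jτ⌋ lies in S, so n = ⌊kt⌋ for some k.  Here k ≤ j because t ≥ τ ≥ 1,
      -- and k < j is impossible: by induction ⌊kt⌋ = ⌊kτ⌋, which is less than n.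
      same-floor : ∀ {t} → t ∈ A → τ ≤ℝ t → ∀ j n → n ℕ.≤ x̂ → IsFloor (j · τ) (+ n) → IsFloor (j · t) (+ n)
      same-floor {t} ((_ , S⊆t) , 1≤t) τ≤t = <-rec _ step
        where
        step : ∀ j → (∀ {k} → k ℕ.< j → ∀ n → n ℕ.≤ x̂ → IsFloor (k · τ) (+ n) → IsFloor (k · t) (+ n)) →
               ∀ n → n ℕ.≤ x̂ → IsFloor (j · τ) (+ n) → IsFloor (j · t) (+ n)
        step ℕ.zero    ih n n≤x̂ floor = floor
        step (ℕ.suc j) ih n n≤x̂ floor@(n≤jτ , jτ<1+n) = compare (S⊆t (small∈S n (ℕ.suc j , floor) n≢0 n≤x̂))
          where
          n≢0 : n ≢ 0
          -- Since τ ≥ 1, a positive multiple of τ cannot have floor 0.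
          n≢0 refl = ℕ.n≮0 (<1+n÷k⇒k<n 0 j {τ} 1≤τ (proj₂ (floor⇒∈[,[ 0 j τ floor)))
          compare : n ∈ Lattice t → IsFloor (ℕ.suc j · t) (+ n)
          compare (k , floor′@(_ , kt<1+n)) with ℕ.<-cmp k (ℕ.suc j)
          ... | tri≈ _ refl _ = floor′
          ... | tri> _ _ j<k  = contradiction kt<1+n (one-multiple-per-unit n (ℕ.suc j) t 1≤t j<k
            λ q → ·-monoʳ-≤ (ℕ.suc j) {τ} {t} τ≤t (n≤jτ q))
          ... | tri< k<j _ _ with <-≤-connex (k · τ) (fromℤ (+ n))
          ...   | inj₂ n≤kτ = contradiction jτ<1+n (one-multiple-per-unit n k τ 1≤τ k<j n≤kτ)
          ...   | inj₁ kτ<n =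
            let m , m<n , floor″ = floor-below (k · τ) (·-nonneg k τ (1≤⇒0< {τ} 1≤τ)) n kτ<n
            in contradiction (floor-unique (k · t) {m} {n} (ih k<j m (ℕ.≤-trans (ℕ.<⇒≤ m<n) n≤x̂) floor″) floor′)
                 (ℕ.<⇒≢ m<n)

      -- Each n in S is the floor of some j · τ and, by `same-floor`, of j · t; monotonicity gives
      -- it for j · s.
      [τ,]⊆A : ∀ {s t} → t ∈ A → τ ≤ℝ s → s ≤ℝ t → s ∈ A
      [τ,]⊆A {s} {t} t∈A τ≤s s≤t = (1≤⇒0< {s} 1≤s , λ {n} n∈S →
        let j , floor = noOutliers n∈S
        in j , floor-between j n {τ} {s} {t} τ≤s s≤t floor
                 (same-floor {t} t∈A (λ q → s≤t (τ≤s q)) j n (proj₂ x̂-max n∈S) floor)) , 1≤s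
        where
        1≤s : 1ℝ ≤ℝ s
        1≤s q = τ≤s (1≤τ q)

      τ∈top : ∀ K → IsTopComponent S K → τ ∈ K
      τ∈top K = gap-free∈top {𝒞 S} {K} {τ} proj₁ τ∈A (λ {s} {t} → [τ,]⊆A {s} {t})

proposition3 : ExcludedMiddle (suc 0ℓ) →
    (S : List ℕ) (x̂ : ℕ) → IsMax S x̂ → (x̂≥1 : x̂ ≥ 1) →
    𝒞 S ≐ ] 0ℝ , 1ℝ ] ∪ ⋃Components (𝒞 S ∩ [ 1ℝ ,+∞[)
    × (∀ K → IsComponent (𝒞 S ∩ [ 1ℝ ,+∞[) K →
    IsInterval K × LengthAtLeast (1/ x̂ ² {{>-nonZero x̂≥1}}) K)
    × ∃! _≐_ (IsTopComponent S)
    × (∀ τ → 1ℝ ≤ℝ τ → NoOutliers S τ → NoMissingValues S τ →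
    ∀ K → IsTopComponent S K → τ ∈ K)
proposition3 em S x̂ x̂-max x̂≥1 =
  𝒞≐]0,1]∪⋃components ,
  (λ K comp-K → component-interval {K} comp-K , component-length {{>-nonZero x̂≥1}} {K} comp-K) ,
  (proj₁ topComponent , proj₂ topComponent , λ {K} → top-unique {𝒞 S} {_} {K} (proj₂ topComponent)) ,
  NoGaps.τ∈top
  where
  open Classical em
  open Compatible S x̂ x̂-max x̂≥1
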